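{- Let $\mathcal{Q}$ be a small quantaloid and let $S\dashv T:\mathbb{D}\to\mathbb{C}$ be an adjunction of $\mathcal{Q}$-functors between $\mathcal{Q}$-categories $\mathbb{C},\mathbb{D}$. A $\mathcal{Q}$-category $\mathbb{X}$ is equivalent to $\mathrm{Fix}(TS)$ if, and only if, there exist essentially surjective type-preserving maps $L:\mathbb{C}_0\to\mathbb{X}_0$ and $R:\mathbb{D}_0\to\mathbb{X}_0$ with $S_{\natural}=\mathbb{X}(L-,R-)$, i.e. $\mathbb{D}(Sc,d)=\mathbb{X}(Lc,Rd)$ for all $c\in\mathbb{C}_0$, $d\in\mathbb{D}_0$.
   Context: A quantaloid $\mathcal{Q}$ is a category whose hom-sets are complete lattices and whose composition $\circ$ preserves joins in each variable; small means it has a set $\mathcal{Q}_0$ of objects; $1_q$ denotes identities. A $\mathcal{Q}$-typed set is a set $A$ with a map $|\cdot|:A\to\mathcal{Q}_0$; maps preserving types are type-preserving. A $\mathcal{Q}$-category $\mathbb{A}$ is a $\mathcal{Q}$-typed set $\mathbb{A}_0$ with arrows $\mathbb{A}(x,y)\in\mathcal{Q}(|x|,|y|)$ such that $1_{|x|}\leq\mathbb{A}(x,x)$ and $\mathbb{A}(y,z)\circ\mathbb{A}(x,y)\leq\mathbb{A}(x,z)$. A $\mathcal{Q}$-subcategory is a subset of objects with the same hom-arrows. The underlying preorder: $x\leq y$ iff $|x|=|y|$ and $1_{|x|}\leq\mathbb{A}(x,y)$; $x\cong y$ means $x\leq y$ and $y\leq x$. A $\mathcal{Q}$-functor $F:\mathbb{A}\to\mathbb{B}$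 is a type-preserving map $\mathbb{A}_0\to\mathbb{B}_0$ with $\mathbb{A}(x,x')\leq\mathbb{B}(Fx,Fx')$; $\mathcal{Q}$-functors are (pre)ordered pointwise, and $F\cong G$ means $F\le G$ and $G\le F$. $S\dashv T:\mathbb{D}\to\mathbb{C}$ means $\mathcal{Q}$-functors $S:\mathbb{C}\to\mathbb{D}$, $T:\mathbb{D}\to\mathbb{C}$ with $1_{\mathbb{C}}\leq TS$ and $ST\leq 1_{\mathbb{D}}$. $\mathrm{Fix}(TS)$ is the $\mathcal{Q}$-subcategory of $\mathbb{C}$ of objects $c$ with $TSc\cong c$. A type-preserving map $F:\mathbb{A}_0\to\mathbb{B}_0$ is essentially surjective if every $y\in\mathbb{B}_0$ satisfies $y\cong Fx$ for some $x\in\mathbb{A}_0$. $\mathbb{A}$ and $\mathbb{B}$ are equivalent if there are $\mathcal{Q}$-functors $F:\mathbb{A}\to\mathbb{B}$, $G:\mathbb{B}\to\mathbb{A}$ with $GF\cong1_{\mathbb{A}}$, $FG\cong1_{\mathbb{B}}$. For a $\mathcal Q$-functor $S:\mathbb C\to\mathbb D$, its graph is $S_\natural(c,d)=\mathbb{D}(Sc,d)$. The maps $L,R$ in the statement are not assumed to be $\mathcal{Q}$-functors. -}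

module Defs where

open import Level using (Level; _⊔_; suc)
open import Data.Product using (Σ; Σ-syntax; ∃-syntax; _×_; _,_; proj₁; proj₂)
open import Relation.Binary.Bundles using (Poset)
open import Relation.Binary.PropositionalEquality using (_≡_; refl; trans; subst₂)

private
  variable
    o a ℓ₁ ℓ₂ ι c d e p : Level

-- Joins and meets are taken of families indexed by types in Set ι, with ι
-- independent of the level of the carrier.  A subset P of the carrier has the
-- join of the family proj₁ : Σ Carrier P → Carrier.
record CompleteLattice (a ℓ₁ ℓ₂ ι : Level) : Set (suc (a ⊔ ℓ₁ ⊔ ℓ₂ ⊔ ι)) where
  field
    poset : Poset a ℓ₁ ℓ₂
  open Poset poset public
  field
    ⋁          : {I : Set ι} → (I → Carrier) → Carrier
    ⋁-upper    : {I : Set ι} (f : I → Carrier) → ∀ i → f i ≤ ⋁ f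
    ⋁-least    : {I : Set ι} (f : I → Carrier) → ∀ u → (∀ i → f i ≤ u) → ⋁ f ≤ u
    ⋀          : {I : Set ι} → (I → Carrier) → Carrier
    ⋀-lower    : {I : Set ι} (f : I → Carrier) → ∀ i → ⋀ f ≤ f i
    ⋀-greatest : {I : Set ι} (f : I → Carrier) → ∀ u → (∀ i → u ≤ f i) → u ≤ ⋀ f

-- The equality of arrows is the one of the hom-lattices; the equality of
-- objects is _≡_.
record Quantaloid (o a ℓ₁ ℓ₂ ι : Level) : Set (suc (o ⊔ a ⊔ ℓ₁ ⊔ ℓ₂ ⊔ ι)) where
  infixr 9 _∘_
  field
    Obj : Set o
    hom : Obj → Obj → CompleteLattice a ℓ₁ ℓ₂ ι

  module Hom {q r : Obj} = CompleteLattice (hom q r)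
  open Hom public using (_≈_; _≤_; ⋁)

  _⇒_ : Obj → Obj → Set a
  q ⇒ r = CompleteLattice.Carrier (hom q r)

  field
    id        : ∀ q → q ⇒ q
    _∘_       : ∀ {q r s} → r ⇒ s → q ⇒ r → q ⇒ s
    ∘-cong    : ∀ {q r s} {g g′ : r ⇒ s} {f f′ : q ⇒ r} →
                g ≈ g′ → f ≈ f′ → g ∘ f ≈ g′ ∘ f′
    assoc     : ∀ {q r s t} (h : s ⇒ t) (g : r ⇒ s) (f : q ⇒ r) →
                (h ∘ g) ∘ f ≈ h ∘ (g ∘ f)
    identityˡ : ∀ {q r} (f : q ⇒ r) → id r ∘ f ≈ f
    identityʳ : ∀ {q r} (f : q ⇒ r) → f ∘ id q ≈ f
    ∘-⋁ʳ      : ∀ {q r s} {I : Set ι} (g : r ⇒ s) (f : I → q ⇒ r) →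
                g ∘ ⋁ f ≈ ⋁ (λ i → g ∘ f i)
    ∘-⋁ˡ      : ∀ {q r s} {I : Set ι} (g : I → r ⇒ s) (f : q ⇒ r) →
                ⋁ g ∘ f ≈ ⋁ (λ i → g i ∘ f)

  -- Types are preserved only up to _≡_, so arrows between equal objects have
  -- to be transported before they can be compared.  Axiom K is in force, so the
  -- result does not depend on the proofs of equality.
  cast : ∀ {q q′ r r′} → q ≡ q′ → r ≡ r′ → q ⇒ r → q′ ⇒ r′
  cast = subst₂ _⇒_

  cast-mono : ∀ {q q′ r r′} (u : q ≡ q′) (v : r ≡ r′) {f g : q ⇒ r} →
              f ≤ g → cast u v f ≤ cast u v g
  cast-mono refl refl f≤g = f≤g

  cast-trans : ∀ {q q′ q″ r r′ r″} (u : q ≡ q′) (u′ : q′ ≡ q″)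
               (v : r ≡ r′) (v′ : r′ ≡ r″) (f : q ⇒ r) →
               cast u′ v′ (cast u v f) ≤ cast (trans u u′) (trans v v′) f
  cast-trans refl refl refl refl f = Hom.refl

module _ (Q : Quantaloid o a ℓ₁ ℓ₂ ι) where
  open Quantaloid Q

  record TypedSet (c : Level) : Set (o ⊔ suc c) where
    field
      Carrier : Set c
      ∣_∣     : Carrier → Obj

  record QCategory (c : Level) : Set (o ⊔ a ⊔ ℓ₂ ⊔ suc c) where
    field
      typedSet : TypedSet c
    open TypedSet typedSet public renaming (Carrier to Ob)
    field
      arr     : (x y : Ob) → ∣ x ∣ ⇒ ∣ y ∣
      id≤arr  : ∀ x → id ∣ x ∣ ≤ arr x x
      ∘≤arr   : ∀ x y z → arr y z ∘ arr x y ≤ arr x z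

module _ {Q : Quantaloid o a ℓ₁ ℓ₂ ι} where
  open Quantaloid Q
  open TypedSet using (Carrier)
  open QCategory using (Ob; typedSet; arr; id≤arr; ∘≤arr)

  infix 4 _[_≤_] _[_≅_] _≤F_ _≅F_ _⊣_ _≃_
  infixr 9 _∘F_

  record TypePreservingMap (A : TypedSet Q c) (B : TypedSet Q d) : Set (o ⊔ c ⊔ d) where
    open TypedSet A using () renaming (∣_∣ to ∣_∣A)
    open TypedSet B using () renaming (∣_∣ to ∣_∣B)
    field
      map      : Carrier A → Carrier B
      preserve : ∀ x → ∣ map x ∣B ≡ ∣ x ∣A

  open TypePreservingMap using (map; preserve)

  _[_≤_] : (A : QCategory Q c) → Ob A → Ob A → Set (o ⊔ ℓ₂)
  A [ x ≤ y ] = Σ[ eq ∈ ∣ x ∣ ≡ ∣ y ∣ ] cast refl eq (id ∣ x ∣) ≤ arr A x y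
    where open QCategory A using (∣_∣)

  _[_≅_] : (A : QCategory Q c) → Ob A → Ob A → Set (o ⊔ ℓ₂)
  A [ x ≅ y ] = A [ x ≤ y ] × A [ y ≤ x ]

  -- The arrow 𝕏(L x, R y), regarded as an arrow from the type of x to that of y.
  _⟨_,_⟩ : {A : TypedSet Q c} {B : TypedSet Q d} (X : QCategory Q e) →
           TypePreservingMap A (typedSet X) → TypePreservingMap B (typedSet X) →
           (x : Carrier A) (y : Carrier B) → TypedSet.∣_∣ A x ⇒ TypedSet.∣_∣ B y
  (X ⟨ L , R ⟩) x y = cast (preserve L x) (preserve R y) (arr X (map L x) (map R y))

  EssentiallySurjective : {A : TypedSet Q c} (X : QCategory Q e) →
                          TypePreservingMap A (typedSet X) → Set (o ⊔ ℓ₂ ⊔ c ⊔ e)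
  EssentiallySurjective X F = ∀ y → ∃[ x ] X [ y ≅ map F x ]

  record QFunctor (A : QCategory Q c) (B : QCategory Q d) : Set (o ⊔ ℓ₂ ⊔ c ⊔ d) where
    field
      typeMap : TypePreservingMap (typedSet A) (typedSet B)
      mono    : ∀ x x′ → arr A x x′ ≤ (B ⟨ typeMap , typeMap ⟩) x x′
    open TypePreservingMap typeMap public

  open QFunctor using (typeMap; mono)

  idF : (A : QCategory Q c) → QFunctor A A
  idF A = record
    { typeMap = record { map = λ x → x ; preserve = λ _ → refl }
    ; mono    = λ _ _ → Hom.refl
    }

  _∘F_ : {A : QCategory Q c} {B : QCategory Q d} {C : QCategory Q e} →
         QFunctor B C → QFunctor A B → QFunctor A C
  _∘F_ {A = A} {B} {C} G F = record
    { typeMap = record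
      { map      = λ x → G.map (F.map x)
      ; preserve = λ x → trans (G.preserve (F.map x)) (F.preserve x)
      }
    ; mono    = λ x x′ →
        Hom.trans (F.mono x x′)
       (Hom.trans (cast-mono (F.preserve x) (F.preserve x′) (G.mono (F.map x) (F.map x′)))
                  (cast-trans (G.preserve (F.map x)) (F.preserve x)
                              (G.preserve (F.map x′)) (F.preserve x′) _))
    }
    where
      module F = QFunctor F
      module G = QFunctor G

  _≤F_ : {A : QCategory Q c} {B : QCategory Q d} → QFunctor A B → QFunctor A B → Set (o ⊔ ℓ₂ ⊔ c)
  _≤F_ {B = B} F G = ∀ x → B [ QFunctor.map F x ≤ QFunctor.map G x ]

  _≅F_ : {A : QCategory Q c} {B : QCategory Q d} → QFunctor A B → QFunctor A B → Set (o ⊔ ℓ₂ ⊔ c)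
  F ≅F G = F ≤F G × G ≤F F

  _⊣_ : {C : QCategory Q c} {D : QCategory Q d} → QFunctor C D → QFunctor D C → Set (o ⊔ ℓ₂ ⊔ c ⊔ d)
  _⊣_ {C = C} {D} S T = idF C ≤F T ∘F S × S ∘F T ≤F idF D

  _≃_ : QCategory Q c → QCategory Q d → Set (o ⊔ ℓ₂ ⊔ c ⊔ d)
  A ≃ B = Σ[ F ∈ QFunctor A B ] Σ[ G ∈ QFunctor B A ] (G ∘F F ≅F idF A × F ∘F G ≅F idF B)

  Subcategory : (A : QCategory Q c) → (Ob A → Set p) → QCategory Q (c ⊔ p)
  Subcategory A P = record
    { typedSet = record { Carrier = Σ (Ob A) P ; ∣_∣ = λ x → QCategory.∣_∣ A (proj₁ x) }
    ; arr      = λ x y → arr A (proj₁ x) (proj₁ y)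
    ; id≤arr   = λ x → id≤arr A (proj₁ x)
    ; ∘≤arr    = λ x y z → ∘≤arr A (proj₁ x) (proj₁ y) (proj₁ z)
    }

  Fix : {C : QCategory Q c} → QFunctor C C → QCategory Q (o ⊔ ℓ₂ ⊔ c)
  Fix {C = C} M = Subcategory C (λ x → C [ QFunctor.map M x ≅ x ])

  graph : {C : QCategory Q c} {D : QCategory Q d} → QFunctor C D →
          (x : Ob C) (y : Ob D) → QCategory.∣_∣ C x ⇒ QCategory.∣_∣ D y
  graph {D = D} S x y = cast (QFunctor.preserve S x) refl (arr D (QFunctor.map S x) y)

{-# OPTIONS --safe #-}
module Submission where

-- Both directions rest on comparing hom-arrows along type-preserving maps.
--
-- Equivalences arise from spans: if a typed set I maps essentially surjectively
-- to A by P and to B by R, and A(P i, P j) = B(R i, R j) for all i, j, then A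
-- and B are equivalent (span⇒≃).  The functors choose, for an object x of A, an
-- index i with x ≅ P i and send x to R i, and conversely.
--
-- Given L and R with D(Sc, d) = X(Lc, Rd), the span X ← D → Fix(TS) formed by R
-- and T satisfies these hypotheses.  Each object of Fix(TS) is isomorphic to
-- some T d, namely for d = Sc.  For the hom-arrows, the adjunction gives
-- C(c, Td) = X(Lc, Rd).  Putting c = Td shows L(Td) ≤ Rd, so
--   X(Rd, Rd') ≤ X(L(Td), Rd') = C(Td, Td').
-- Writing Rd ≅ Lc instead gives c ≤ Td, so
--   C(Td, Td') ≤ C(c, Td') = X(Lc, Rd') = X(Rd, Rd').
--
-- Given an equivalence with G : Fix(TS) → X, put Lc = G(TSc) and Rd = G(Td).
-- As G is fully faithful,
--   X(Lc, Rd) = C(TSc, Td) = D(STSc, d) = D(Sc, d);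
-- and an object y ≅ G(c) with c fixed is isomorphic to both Lc and R(Sc).

open import Defs
open import Level using (Level; _⊔_; Lift; lift)
open import Data.Bool using (Bool; true; false)
open import Data.Product using (Σ-syntax; _×_; _,_; proj₁; proj₂; swap)
open import Function.Bundles using (_⇔_; mk⇔)
open import Relation.Binary.PropositionalEquality using (_≡_; refl; sym)
  renaming (trans to ≡-trans)

private
  variable
    o a ℓ₁ ℓ₂ ι c d e x : Level

module _ {Q : Quantaloid o a ℓ₁ ℓ₂ ι} where
  open Quantaloid Q
  open QCategory using (Ob; typedSet; arr; id≤arr; ∘≤arr)

  -- Monotonicity of composition

  -- Preservation of joins gives monotonicity because g ≤ g′ says that g′ is the
  -- join of the pair g, g′.
  ∘-monoˡ : ∀ {q r s} {g g′ : r ⇒ s} (f : q ⇒ r) → g ≤ g′ → g ∘ f ≤ g′ ∘ f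
  ∘-monoˡ {r = r} {s} {g} {g′} f g≤g′ =
    Hom.trans (Hom.⋁-upper (λ b → pair b ∘ f) (lift true))
      (Hom.reflexive (Hom.Eq.trans (Hom.Eq.sym (∘-⋁ˡ pair f)) (∘-cong ⋁≈g′ Hom.Eq.refl)))
    where
    pair : Lift ι Bool → r ⇒ s
    pair (lift true)  = g
    pair (lift false) = g′

    ⋁≈g′ : ⋁ pair ≈ g′
    ⋁≈g′ = Hom.antisym
      (Hom.⋁-least pair g′ λ { (lift true) → g≤g′ ; (lift false) → Hom.refl })
      (Hom.⋁-upper pair (lift false))

  ∘-monoʳ : ∀ {q r s} (g : r ⇒ s) {f f′ : q ⇒ r} → f ≤ f′ → g ∘ f ≤ g ∘ f′
  ∘-monoʳ {q} {r} g {f} {f′} f≤f′ =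
    Hom.trans (Hom.⋁-upper (λ b → g ∘ pair b) (lift true))
      (Hom.reflexive (Hom.Eq.trans (Hom.Eq.sym (∘-⋁ʳ g pair)) (∘-cong Hom.Eq.refl ⋁≈f′)))
    where
    pair : Lift ι Bool → q ⇒ r
    pair (lift true)  = f
    pair (lift false) = f′

    ⋁≈f′ : ⋁ pair ≈ f′
    ⋁≈f′ = Hom.antisym
      (Hom.⋁-least pair f′ λ { (lift true) → f≤f′ ; (lift false) → Hom.refl })
      (Hom.⋁-upper pair (lift false))

  -- Comparison of arrows whose domains and codomains are equal only
  -- propositionally.  Being an inductive family, it absorbs every cast.

  infix 4 _≼_ _≋_

  -- The arrow f lies below g; in particular f and g have equal domains and
  -- equal codomains.
  data _≼_ {q r : Obj} (f : q ⇒ r) : {q′ r′ : Obj} → q′ ⇒ r′ → Set (a ⊔ ℓ₂) where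
    within : {g : q ⇒ r} → f ≤ g → f ≼ g

  -- Equality of arrows in the same sense.
  _≋_ : ∀ {q r q′ r′} → q ⇒ r → q′ ⇒ r′ → Set (a ⊔ ℓ₂)
  f ≋ g = (f ≼ g) × (g ≼ f)

  ≼-trans : ∀ {q r q′ r′ q″ r″} {f : q ⇒ r} {g : q′ ⇒ r′} {h : q″ ⇒ r″} →
            f ≼ g → g ≼ h → f ≼ h
  ≼-trans (within f≤g) (within g≤h) = within (Hom.trans f≤g g≤h)

  ≋-sym : ∀ {q r q′ r′} {f : q ⇒ r} {g : q′ ⇒ r′} → f ≋ g → g ≋ f
  ≋-sym = swap

  ≋-trans : ∀ {q r q′ r′ q″ r″} {f : q ⇒ r} {g : q′ ⇒ r′} {h : q″ ⇒ r″} →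
            f ≋ g → g ≋ h → f ≋ h
  ≋-trans (f≼g , g≼f) (g≼h , h≼g) = ≼-trans f≼g g≼h , ≼-trans h≼g g≼f

  ≈⇒≋ : ∀ {q r} {f g : q ⇒ r} → f ≈ g → f ≋ g
  ≈⇒≋ f≈g = within (Hom.reflexive f≈g) , within (Hom.reflexive (Hom.Eq.sym f≈g))

  ≼⇒≤ : ∀ {q r} {f g : q ⇒ r} → f ≼ g → f ≤ g
  ≼⇒≤ (within f≤g) = f≤g

  ≋⇒≈ : ∀ {q r} {f g : q ⇒ r} → f ≋ g → f ≈ g
  ≋⇒≈ (f≼g , g≼f) = Hom.antisym (≼⇒≤ f≼g) (≼⇒≤ g≼f)

  cast-≋ : ∀ {q q′ r r′} (u : q ≡ q′) (v : r ≡ r′) (f : q ⇒ r) → cast u v f ≋ f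
  cast-≋ refl refl f = within Hom.refl , within Hom.refl

  -- The underlying preorder of a category, by means of ≼

  ≤⇒≼ : (A : QCategory Q c) {x y : Ob A} →
        A [ x ≤ y ] → id (QCategory.∣_∣ A x) ≼ arr A x y
  ≤⇒≼ A (eq , p) = ≼-trans (proj₂ (cast-≋ refl eq (id _))) (within p)

  -- Any identity will do: lying below arr A x y, it is that of the type of x.
  id≼⇒≤ : (A : QCategory Q c) {x y : Ob A} {q : Obj} →
         id q ≼ arr A x y → A [ x ≤ y ]
  id≼⇒≤ A = go
    where
    go : ∀ {q r s} {g : r ⇒ s} → id q ≼ g → Σ[ eq ∈ r ≡ s ] cast refl eq (id r) ≤ g
    go (within p) = refl , p

  -- The preorder is reflected and preserved by any comparison of hom-arrows.
  ≤-transport : (A : QCategory Q c) (B : QCategory Q d) {x y : Ob A} {x′ y′ : Ob B} →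
                arr A x y ≼ arr B x′ y′ → A [ x ≤ y ] → B [ x′ ≤ y′ ]
  ≤-transport A B h x≤y = id≼⇒≤ B (≼-trans (≤⇒≼ A x≤y) h)

  ≅-transport : (A : QCategory Q c) (B : QCategory Q d) {x y : Ob A} {x′ y′ : Ob B} →
                arr A x y ≼ arr B x′ y′ → arr A y x ≼ arr B y′ x′ →
                A [ x ≅ y ] → B [ x′ ≅ y′ ]
  ≅-transport A B h k (x≤y , y≤x) = ≤-transport A B h x≤y , ≤-transport A B k y≤x

  ≤-refl : (A : QCategory Q c) (x : Ob A) → A [ x ≤ x ]
  ≤-refl A x = refl , id≤arr A x

  arr-antitone : (A : QCategory Q c) {x y : Ob A} (z : Ob A) →
                 A [ x ≤ y ] → arr A y z ≼ arr A x z
  arr-antitone A {x} {y} z (eq , p) = ≼-trans (go eq p (arr A y z)) (within (∘≤arr A x y z))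
    where
    go : ∀ {q r s} (u : q ≡ r) {f : q ⇒ r} → cast refl u (id q) ≤ f →
         (g : r ⇒ s) → g ≼ g ∘ f
    go refl id≤f g =
      within (Hom.trans (Hom.reflexive (Hom.Eq.sym (identityʳ g))) (∘-monoʳ g id≤f))

  arr-monotone : (A : QCategory Q c) {y z : Ob A} (x : Ob A) →
                 A [ y ≤ z ] → arr A x y ≼ arr A x z
  arr-monotone A {y} {z} x (eq , p) = ≼-trans (go eq p (arr A x y)) (within (∘≤arr A x y z))
    where
    go : ∀ {q r s} (u : r ≡ s) {g : r ⇒ s} → cast refl u (id r) ≤ g →
         (f : q ⇒ r) → f ≼ g ∘ f
    go refl id≤g f =
      within (Hom.trans (Hom.reflexive (Hom.Eq.sym (identityˡ f))) (∘-monoˡ f id≤g))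

  arr-congˡ : (A : QCategory Q c) {x y : Ob A} (z : Ob A) →
              A [ x ≅ y ] → arr A x z ≋ arr A y z
  arr-congˡ A z (x≤y , y≤x) = arr-antitone A z y≤x , arr-antitone A z x≤y

  arr-congʳ : (A : QCategory Q c) {y z : Ob A} (x : Ob A) →
              A [ y ≅ z ] → arr A x y ≋ arr A x z
  arr-congʳ A x (y≤z , z≤y) = arr-monotone A x y≤z , arr-monotone A x z≤y

  arr-cong : (A : QCategory Q c) {x x′ y y′ : Ob A} →
             A [ x ≅ x′ ] → A [ y ≅ y′ ] → arr A x y ≋ arr A x′ y′
  arr-cong A {x′ = x′} {y} x≅x′ y≅y′ =
    ≋-trans (arr-congˡ A y x≅x′) (arr-congʳ A x′ y≅y′)

  ≤-trans : (A : QCategory Q c) {x y z : Ob A} → A [ x ≤ y ] → A [ y ≤ z ] → A [ x ≤ z ]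
  ≤-trans A {x} x≤y y≤z = ≤-transport A A (arr-monotone A x y≤z) x≤y

  ≅-sym : (A : QCategory Q c) {x y : Ob A} → A [ x ≅ y ] → A [ y ≅ x ]
  ≅-sym A = swap

  ≅-trans : (A : QCategory Q c) {x y z : Ob A} → A [ x ≅ y ] → A [ y ≅ z ] → A [ x ≅ z ]
  ≅-trans A (x≤y , y≤x) (y≤z , z≤y) = ≤-trans A x≤y y≤z , ≤-trans A z≤y y≤x

  ≅⇒≡ : (A : QCategory Q c) {x y : Ob A} → A [ x ≅ y ] →
        QCategory.∣_∣ A x ≡ QCategory.∣_∣ A y
  ≅⇒≡ A ((eq , _) , _) = eq

  -- Functors and equivalences

  mono-≼ : {A : QCategory Q c} {B : QCategory Q d} (F : QFunctor A B) (x y : Ob A) →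
           arr A x y ≼ arr B (QFunctor.map F x) (QFunctor.map F y)
  mono-≼ F x y =
    ≼-trans (within (F.mono x y)) (proj₁ (cast-≋ (F.preserve x) (F.preserve y) _))
    where module F = QFunctor F

  map-≤ : {A : QCategory Q c} {B : QCategory Q d} (F : QFunctor A B) {x y : Ob A} →
          A [ x ≤ y ] → B [ QFunctor.map F x ≤ QFunctor.map F y ]
  map-≤ {A = A} {B} F = ≤-transport A B (mono-≼ F _ _)

  map-≅ : {A : QCategory Q c} {B : QCategory Q d} (F : QFunctor A B) {x y : Ob A} →
          A [ x ≅ y ] → B [ QFunctor.map F x ≅ QFunctor.map F y ]
  map-≅ F (x≤y , y≤x) = map-≤ F x≤y , map-≤ F y≤x

  -- A functor with a left inverse up to isomorphism is fully faithful.
  leftInverse⇒fullyFaithful :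
    {A : QCategory Q c} {B : QCategory Q d} (F : QFunctor A B) (G : QFunctor B A) →
    G ∘F F ≅F idF A → (x y : Ob A) →
    arr A x y ≋ arr B (QFunctor.map F x) (QFunctor.map F y)
  leftInverse⇒fullyFaithful {A = A} F G (GF≤1 , 1≤GF) x y =
    mono-≼ F x y ,
    ≼-trans (mono-≼ G _ _) (proj₁ (arr-cong A (GF≤1 x , 1≤GF x) (GF≤1 y , 1≤GF y)))

  module _ (A : QCategory Q c) (B : QCategory Q d) {I : TypedSet Q e}
           (P : TypePreservingMap I (typedSet A)) (R : TypePreservingMap I (typedSet B))
    where
    private
      module I = TypedSet I
      module A = QCategory A
      module B = QCategory B
      module P = TypePreservingMap P
      module R = TypePreservingMap R

    -- One half of a span equivalence: x ↦ R i, for the index i with x ≅ P i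
    -- supplied by the essential surjectivity of P.
    spanFunctor : EssentiallySurjective A P →
                  (∀ i j → arr A (P.map i) (P.map j) ≼ arr B (R.map i) (R.map j)) →
                  QFunctor A B
    spanFunctor surjP h = record
      { typeMap = record { map = λ x → R.map (index x) ; preserve = preserve }
      ; mono    = λ x y → ≼⇒≤
          (≼-trans (proj₁ (arr-cong A (x≅Pi x) (x≅Pi y)))
          (≼-trans (h (index x) (index y)) (proj₂ (cast-≋ (preserve x) (preserve y) _))))
      }
      where
      index : A.Ob → I.Carrier
      index x = proj₁ (surjP x)

      x≅Pi : ∀ x → A [ x ≅ P.map (index x) ]
      x≅Pi x = proj₂ (surjP x)

      preserve : ∀ x → B.∣ R.map (index x) ∣ ≡ A.∣ x ∣
      preserve x = ≡-trans (R.preserve (index x))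
        (≡-trans (sym (P.preserve (index x))) (sym (≅⇒≡ A (x≅Pi x))))

  span⇒≃ : (A : QCategory Q c) (B : QCategory Q d) {I : TypedSet Q e}
           (P : TypePreservingMap I (typedSet A)) (R : TypePreservingMap I (typedSet B)) →
           EssentiallySurjective A P → EssentiallySurjective B R →
           (∀ i j → arr A (TypePreservingMap.map P i) (TypePreservingMap.map P j)
                  ≋ arr B (TypePreservingMap.map R i) (TypePreservingMap.map R j)) →
           A ≃ B
  span⇒≃ A B P R surjP surjR h =
    F , G ,
    ((λ x → proj₁ (inverseA x)) , (λ x → proj₂ (inverseA x))) ,
    ((λ y → proj₁ (inverseB y)) , (λ y → proj₂ (inverseB y)))
    where
    F : QFunctor A B
    F = spanFunctor A B P R surjP (λ i j → proj₁ (h i j))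

    G : QFunctor B A
    G = spanFunctor B A R P surjR (λ i j → proj₂ (h i j))

    -- If i is the index chosen for x and j the one chosen for R i, then
    -- R i ≅ R j yields P i ≅ P j, hence x ≅ P i ≅ P j.
    inverseA : ∀ x → A [ QFunctor.map (G ∘F F) x ≅ x ]
    inverseA x with surjP x
    ... | i , x≅Pi with surjR (TypePreservingMap.map R i)
    ...   | j , Ri≅Rj = ≅-sym A
      (≅-trans A x≅Pi (≅-transport B A (proj₂ (h i j)) (proj₂ (h j i)) Ri≅Rj))

    inverseB : ∀ y → B [ QFunctor.map (F ∘F G) y ≅ y ]
    inverseB y with surjR y
    ... | j , y≅Rj with surjP (TypePreservingMap.map P j)
    ...   | i , Pj≅Pi = ≅-sym B
      (≅-trans B y≅Rj (≅-transport A B (proj₁ (h j i)) (proj₁ (h i j)) Pj≅Pi))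

  -- Fixed objects of an adjunction

  module Adjunction {C : QCategory Q c} {D : QCategory Q d}
                    (S : QFunctor C D) (T : QFunctor D C) (S⊣T : S ⊣ T) where
    private
      module C = QCategory C
      module D = QCategory D
      module S = QFunctor S
      module T = QFunctor T

    unit : ∀ y → C [ y ≤ T.map (S.map y) ]
    unit = proj₁ S⊣T

    counit : ∀ z → D [ S.map (T.map z) ≤ z ]
    counit = proj₂ S⊣T

    transpose : ∀ y z → arr D (S.map y) z ≋ arr C y (T.map z)
    transpose y z =
      ≼-trans (mono-≼ T _ _) (arr-antitone C (T.map z) (unit y)) ,
      ≼-trans (mono-≼ S _ _) (arr-monotone D (S.map y) (counit z))

    TST≅T : ∀ z → C [ T.map (S.map (T.map z)) ≅ T.map z ]
    TST≅T z = map-≤ T (counit z) , unit (T.map z)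

    STS≅S : ∀ y → D [ S.map (T.map (S.map y)) ≅ S.map y ]
    STS≅S y = counit (S.map y) , map-≤ S (unit y)

    FixTS : QCategory Q _
    FixTS = Fix (T ∘F S)

    -- The map T, regarded as taking values in the fixed objects.
    T-Fix : TypePreservingMap D.typedSet (typedSet FixTS)
    T-Fix = record { map = λ z → T.map z , TST≅T z ; preserve = T.preserve }

    T-Fix-surjective : EssentiallySurjective FixTS T-Fix
    T-Fix-surjective (y , TSy≅y) = S.map y , ≅-sym C TSy≅y

    -- Likewise for the composite of T and S.
    TS-Fix : TypePreservingMap C.typedSet (typedSet FixTS)
    TS-Fix = record
      { map      = λ y → TypePreservingMap.map T-Fix (S.map y)
      ; preserve = QFunctor.preserve (T ∘F S)
      }

    TS-Fix-surjective : EssentiallySurjective FixTS TS-Fix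
    TS-Fix-surjective (y , TSy≅y) = y , ≅-sym C TSy≅y

    graph-TS : ∀ y z → arr D (S.map y) z ≋ arr C (T.map (S.map y)) (T.map z)
    graph-TS y z =
      ≋-trans (≋-sym (arr-congˡ D z (STS≅S y))) (transpose (T.map (S.map y)) z)

    graph-≋ : ∀ y z → graph S y z ≋ arr D (S.map y) z
    graph-≋ y z = cast-≋ (S.preserve y) refl _

    -- A factorization of the graph of S through the hom-arrows of X, by
    -- essentially surjective maps.
    Factorization : QCategory Q x → Set _
    Factorization X =
      Σ[ L ∈ TypePreservingMap C.typedSet (typedSet X) ]
      Σ[ R ∈ TypePreservingMap D.typedSet (typedSet X) ]
        (EssentiallySurjective X L × EssentiallySurjective X R ×
         (∀ y z → graph S y z ≈ (X ⟨ L , R ⟩) y z))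

    ≃⇒factorization : (X : QCategory Q x) → X ≃ FixTS → Factorization X
    ≃⇒factorization X (F , G , (GF≤1 , 1≤GF) , FG≅1) =
      postcompose TS-Fix , postcompose T-Fix ,
      surjective TS-Fix TS-Fix-surjective , surjective T-Fix T-Fix-surjective ,
      λ y z → ≋⇒≈
        (≋-trans (graph-≋ y z)
        (≋-trans (graph-TS y z)
        (≋-trans (leftInverse⇒fullyFaithful G F FG≅1
                   (TypePreservingMap.map TS-Fix y) (TypePreservingMap.map T-Fix z))
                 (≋-sym (cast-≋ (TypePreservingMap.preserve (postcompose TS-Fix) y)
                                (TypePreservingMap.preserve (postcompose T-Fix) z) _)))))
      where
      module F = QFunctor F
      module G = QFunctor G

      postcompose : {I : TypedSet Q e} → TypePreservingMap I (typedSet FixTS) →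
                    TypePreservingMap I (typedSet X)
      postcompose K = record
        { map      = λ i → G.map (K.map i)
        ; preserve = λ i → ≡-trans (G.preserve (K.map i)) (K.preserve i)
        }
        where
        module K = TypePreservingMap K

      surjective : {I : TypedSet Q e} (K : TypePreservingMap I (typedSet FixTS)) →
                   EssentiallySurjective FixTS K → EssentiallySurjective X (postcompose K)
      surjective K surjK x with surjK (F.map x)
      ... | i , Fx≅Ki = i , ≅-trans X (1≤GF x , GF≤1 x) (map-≅ G Fx≅Ki)

    factorization⇒≃ : (X : QCategory Q x) → Factorization X → X ≃ FixTS
    factorization⇒≃ X (L , R , surjL , surjR , S♮≈X) =
      span⇒≃ X FixTS R T-Fix surjR T-Fix-surjective hom-≋
      where
      module L = TypePreservingMap L
      module R = TypePreservingMap R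

      X-≋-C : ∀ y z → arr X (L.map y) (R.map z) ≋ arr C y (T.map z)
      X-≋-C y z =
        ≋-trans (≋-sym (cast-≋ (L.preserve y) (R.preserve z) _))
        (≋-trans (≋-sym (≈⇒≋ (S♮≈X y z)))
        (≋-trans (graph-≋ y z) (transpose y z)))

      -- L(Tz) ≤ Rz corresponds to the identity inequality Tz ≤ Tz.
      LT≤R : ∀ z → X [ L.map (T.map z) ≤ R.map z ]
      LT≤R z = ≤-transport C X (proj₂ (X-≋-C (T.map z) z)) (≤-refl C (T.map z))

      hom-≋ : ∀ z z′ → arr X (R.map z) (R.map z′) ≋ arr C (T.map z) (T.map z′)
      hom-≋ z z′ =
        ≼-trans (arr-antitone X (R.map z′) (LT≤R z)) (proj₁ (X-≋-C (T.map z) z′)) ,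
        backward (surjL (R.map z))
        where
        backward : Σ[ y ∈ C.Ob ] X [ R.map z ≅ L.map y ] →
                   arr C (T.map z) (T.map z′) ≼ arr X (R.map z) (R.map z′)
        backward (y , R≤L , L≤R) =
          ≼-trans (arr-antitone C (T.map z′) y≤Tz)
          (≼-trans (proj₂ (X-≋-C y z′)) (arr-antitone X (R.map z′) R≤L))
          where
          y≤Tz : C [ y ≤ T.map z ]
          y≤Tz = ≤-transport X C (proj₁ (X-≋-C y z)) L≤R

corollary3p5 : {o a ℓ₁ ℓ₂ ι c d x : Level} (Q : Quantaloid o a ℓ₁ ℓ₂ ι)
    (C : QCategory Q c) (D : QCategory Q d)
    (S : QFunctor C D) (T : QFunctor D C) → S ⊣ T →
    (X : QCategory Q x) →
    (X ≃ Fix (T ∘F S)) ⇔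
    (Σ[ L ∈ TypePreservingMap (QCategory.typedSet C) (QCategory.typedSet X) ]
    Σ[ R ∈ TypePreservingMap (QCategory.typedSet D) (QCategory.typedSet X) ]
    (EssentiallySurjective X L × EssentiallySurjective X R ×
    (∀ y z → Quantaloid._≈_ Q (graph S y z) ((X ⟨ L , R ⟩) y z))))
corollary3p5 Q C D S T S⊣T X = mk⇔ (≃⇒factorization X) (factorization⇒≃ X)
  where open Adjunction S T S⊣T
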